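{- Let $\mathfrak z$ be an ordinal and let $(r_{\mathsf g,\mathfrak z},q_{\mathsf g,\mathfrak z},\sqsubseteq_{\mathbf{Ord}})$ be the ranking domain on $\mathbf{Ord}_{\le\mathfrak z}$ defined in the context. Then: 1. Let $c:X\to F_{\mathsf g}X$ be an $F_{\mathsf g}$-coalgebra. A function $b:X\to\mathbf{Ord}_{\le\mathfrak z}$ is a ranking arrow for $c$ with respect to $(r_{\mathsf g,\mathfrak z},q_{\mathsf g,\mathfrak z},\sqsubseteq_{\mathbf{Ord}})$ if and only if $b$ is a ranking function for the game structure $G^c$ and the set $\mathrm{Acc}^c$. 2. Let $G=(X_{\max},X_{\min},\tau)$ be a game structure and $\mathrm{Acc}\subseteq X_{\max}$. A function $b:X_{\max}\to\mathbf{Ord}_{\le\mathfrak z}$ is a ranking function for $G$ and $\mathrm{Acc}$ if and only if $b$ is a ranking arrow for $c^{G,\mathrm{Acc}}$ with respect to $(r_{\mathsf g,\mathfrak z},q_{\mathsf g,\mathfrak z},\sqsubseteq_{\mathbf{Ord}})$. 3. For each function $b:X\to\mathbf{Ord}_{\le\mathfrak z}$ and $x\in X$: $b(x)<\mathfrak z$ if and only if $q_{\mathsf g,\mathfrak z}(b(x))=1$.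
   Context: $F_{\mathsf g}=\mathcal P^2(-)\times\{0,1\}$ on $\mathbf{Sets}$ with $\mathcal P$ the covariant powerset functor, so $F_{\mathsf g}f(\Gamma,t)=(\{\{f(x)\mid x\in A\}\mid A\in\Gamma\},t)$. A coalgebra is a function $c:X\to F_{\mathsf g}X$; write $c(x)=(c_1(x),c_2(x))$. $\mathbf{Ord}_{\le\mathfrak z}$ is the set of ordinals $\le\mathfrak z$; $\mathfrak a\mathbin{\widehat+}1=\min\{\mathfrak a+1,\mathfrak z\}$. $r_{\mathsf g,\mathfrak z}:F_{\mathsf g}\mathbf{Ord}_{\le\mathfrak z}\to\mathbf{Ord}_{\le\mathfrak z}$ is $r_{\mathsf g,\mathfrak z}(\Gamma,1)=0$, $r_{\mathsf g,\mathfrak z}(\Gamma,0)=\min_{A\in\Gamma}\sup_{\mathfrak a\in A}(\mathfrak a\mathbin{\widehat+}1)$; $q_{\mathsf g,\mathfrak z}(\mathfrak z)=0$ and $q_{\mathsf g,\mathfrak z}(\mathfrak a)=1$ for $\mathfrak a<\mathfrak z$; $\mathfrak a\sqsubseteq_{\mathbf{Ord}}\mathfrak b$ iff $\mathfrak a\ge\mathfrak b$. In $\mathbf{Ord}_{\le\mathfrak z}$, $\sup\emptyset=0$ and $\min\emptyset=\mathfrak z$. A ranking arrow for $c:X\to F_{\mathsf g}X$ is $b:X\to\mathbf{Ord}_{\le\mathfrak z}$ with $b\sqsubseteq_{\mathbf{Ord}}r_{\mathsf g,\mathfrak z}\circ F_{\mathsf g}b\circ c$ pointwise. A game structure is $G=(X_{\max},X_{\min},\tau)$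 with (disjoint) sets $X_{\max},X_{\min}$ and $\tau\subseteq X_{\max}\times X_{\min}\cup X_{\min}\times X_{\max}$. Given $\mathrm{Acc}\subseteq X_{\max}$, a ranking function for $G$ and $\mathrm{Acc}$ is $b:X_{\max}\to\mathbf{Ord}_{\le\mathfrak z}$ such that for each $x\in X_{\max}\setminus\mathrm{Acc}$: $\min_{y:(x,y)\in\tau}\sup_{x':(y,x')\in\tau}(b(x')\mathbin{\widehat+}1)\le b(x)$. For a coalgebra $c:X\to F_{\mathsf g}X$: $G^c=(X,\mathcal PX,\tau^c)$ (the two sets regarded as disjoint) with $\tau^c=\{(x,A)\mid x\in X,A\in c_1(x)\}\cup\{(A,x')\mid A\in\mathcal PX,x'\in A\}$, and $\mathrm{Acc}^c=\{x\mid c_2(x)=1\}$. For $G$ and $\mathrm{Acc}$: $c^{G,\mathrm{Acc}}:X_{\max}\to F_{\mathsf g}X_{\max}$ is $c^{G,\mathrm{Acc}}(x)=(\{\{x'\mid(y,x')\in\tau\}\mid y\in X_{\min},(x,y)\in\tau\},t)$ with $t=1$ if $x\in\mathrm{Acc}$ and $t=0$ otherwise. -}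

module Defs where

open import Axiom.ExcludedMiddle using (ExcludedMiddle)
open import Data.Bool.Base using (Bool; true; false)
open import Data.Product.Base using (∃; _×_; _,_; proj₁; proj₂)
open import Data.Sum.Base using (_⊎_; inj₁; inj₂)
open import Induction.WellFounded using (WellFounded; Acc; acc)
open import Level using (Level; _⊔_; suc)
open import Relation.Binary.Core using (Rel; REL)
open import Relation.Binary.Definitions using (Trichotomous; tri<; tri≈; tri>)
open import Relation.Binary.Structures using (IsStrictTotalOrder)
import Relation.Binary.Construct.Add.Supremum.Strict as AddSupremum
open import Relation.Binary.PropositionalEquality.Core using (_≡_; refl)
open import Relation.Nullary.Construct.Add.Supremum using (_⁺; [_]; ⊤⁺)
open import Relation.Nullary.Decidable.Core using (does; yes; no)
open import Relation.Nullary.Negation.Core using (contradiction)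
open import Relation.Unary using (Pred; ∅; _∈_; _∉_; _≐_)
open import Relation.Unary.Properties using (≐-trans)

private
  variable
    a p ℓ : Level

-- { f x ∣ x ∈ P }
image : ∀ {a b p} {A : Set a} {B : Set b} → (A → B) → Pred A p → Pred B (a ⊔ b ⊔ p)
image f P y = ∃ λ x → x ∈ P × f x ≡ y

------------------------------------------------------------------------
-- The functor 𝒫²(-) × {0,1}

𝒫 : Set ℓ → Set (suc ℓ)
𝒫 {ℓ} X = Pred X ℓ

-- Subsets are identified up to _≐_, so a set of subsets has to be closed
-- under _≐_.
record 𝒫² {ℓ} (X : Set ℓ) : Set (suc (suc ℓ)) where
  field
    sets : Pred (𝒫 X) (suc ℓ)
    resp : ∀ {A B} → A ≐ B → A ∈ sets → B ∈ sets

open 𝒫² public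

-- { S i ∣ i ∈ P }
setOf : {I : Set (suc ℓ)} {X : Set ℓ} → (I → 𝒫 X) → Pred I (suc ℓ) → 𝒫² X
setOf S P = record
  { sets = λ B → ∃ λ i → i ∈ P × S i ≐ B
  ; resp = λ B≐C (i , i∈P , Si≐B) → i , i∈P , ≐-trans Si≐B B≐C
  }

-- {0,1} is Bool, with 1 = true and 0 = false.
F : Set ℓ → Set (suc (suc ℓ))
F X = 𝒫² X × Bool

F₁ : {X Y : Set ℓ} → (X → Y) → F X → F Y
F₁ f (Γ , t) = setOf (image f) (sets Γ) , t

Coalgebra : Set ℓ → Set (suc (suc ℓ))
Coalgebra X = X → F X

IsRankingArrow : {R X : Set ℓ} → (F R → R) → Rel R ℓ → Coalgebra X → (X → R) → Set ℓ
IsRankingArrow r _⊑_ c b = ∀ x → b x ⊑ r (F₁ b (c x))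

------------------------------------------------------------------------
-- Game structures

-- τ ⊆ Xmax × Xmin ∪ Xmin × Xmax is given by its two parts.  As 𝒫 X lives one
-- universe above X, so does Xmin above Xmax.
record GameStructure ℓ : Set (suc (suc ℓ)) where
  field
    Xmax : Set ℓ
    Xmin : Set (suc ℓ)
    τmax : REL Xmax Xmin (suc ℓ)
    τmin : REL Xmin Xmax ℓ

open GameStructure public

gameOf : {X : Set ℓ} → Coalgebra X → GameStructure ℓ
gameOf {X = X} c = record
  { Xmax = X
  ; Xmin = 𝒫 X
  ; τmax = λ x A → A ∈ sets (proj₁ (c x))
  ; τmin = λ A x′ → x′ ∈ A
  }

acceptingOf : {X : Set ℓ} → Coalgebra X → Pred X _
acceptingOf c x = proj₂ (c x) ≡ true

------------------------------------------------------------------------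
-- Ordinals

-- An ordinal 𝔷 is presented, up to order isomorphism, by a well-ordered set;
-- the elements of Carrier stand for the ordinals below 𝔷.
record Ordinal ℓ : Set (suc ℓ) where
  field
    Carrier            : Set ℓ
    _<_                : Rel Carrier ℓ
    isStrictTotalOrder : IsStrictTotalOrder _≡_ _<_
    wellFounded        : WellFounded _<_

-- Excluded middle is needed for minima to exist, and for the characteristic
-- function of a set of accepting states.
module Classical (em : ∀ {a} → ExcludedMiddle a) where

  coalgebraOf : (G : GameStructure ℓ) → Pred (Xmax G) a → Coalgebra (Xmax G)
  coalgebraOf G Acc x = setOf (τmin G) (τmax G x) , does (em {P = x ∈ Acc})

  module Ord≤ {ℓ} (𝔷 : Ordinal ℓ) where

    open Ordinal 𝔷 using (Carrier; isStrictTotalOrder; wellFounded)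
      renaming (_<_ to _<₀_)

    -- [ k ] is an ordinal below 𝔷, and ⊤⁺ is 𝔷 itself.
    Ord : Set ℓ
    Ord = Carrier ⁺

    open AddSupremum _<₀_ public using () renaming (_<⁺_ to _<_)
    open AddSupremum _<₀_ using ([_]; [_]<⊤⁺; <⁺-cmp-≡)

    infix 4 _≤_ _⊑_

    _≤_ : Rel Ord ℓ
    x ≤ y = x < y ⊎ x ≡ y

    _⊑_ : Rel Ord ℓ
    x ⊑ y = y ≤ x

    <-cmp : Trichotomous _≡_ _<_
    <-cmp = <⁺-cmp-≡ (IsStrictTotalOrder.compare isStrictTotalOrder)

    <-wellFounded : WellFounded _<_
    <-wellFounded [ k ] = acc-[] (wellFounded k)
      where
      acc-[] : ∀ {k} → Acc _<₀_ k → Acc _<_ [ k ]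
      acc-[] (acc rs) = acc λ { [ j<k ] → acc-[] (rs j<k) }
    <-wellFounded ⊤⁺ = acc λ { [ k ]<⊤⁺ → <-wellFounded [ k ] }

    IsLeast : Pred Ord p → Ord → Set (ℓ ⊔ p)
    IsLeast S m = m ∈ S × (∀ {y} → y ∈ S → m ≤ y)

    least : (S : Pred Ord p) → ∃ S → ∃ (IsLeast S)
    least S (x , x∈S) = go x∈S (<-wellFounded x)
      where
      go : ∀ {x} → x ∈ S → Acc _<_ x → ∃ (IsLeast S)
      go {x} x∈S (acc rs) with em {P = ∃ λ y → y < x × y ∈ S}
      ... | yes (y , y<x , y∈S) = go y∈S (rs y<x)
      ... | no ¬smaller         = x , x∈S , below
        where
        below : ∀ {y} → y ∈ S → x ≤ y
        below {y} y∈S with <-cmp x y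
        ... | tri< x<y _ _ = inj₁ x<y
        ... | tri≈ _ x≡y _ = inj₂ x≡y
        ... | tri> _ _ y<x = contradiction (y , y<x , y∈S) ¬smaller

    min : Pred Ord p → Ord
    min S with em {P = ∃ S}
    ... | yes nonempty = proj₁ (least S nonempty)
    ... | no  _        = ⊤⁺

    -- Every set has the upper bound 𝔷, so this is the least upper bound.
    sup : Pred Ord p → Ord
    sup S = min λ u → ∀ {x} → x ∈ S → x ≤ u

    𝟎 : Ord
    𝟎 = sup ∅

    -- x ∔1 = min { x + 1 , 𝔷 }; if x < 𝔷, then x + 1 ≤ 𝔷 is the least ordinal
    -- above x.
    _∔1 : Ord → Ord
    [ k ] ∔1 = min ([ k ] <_)
    ⊤⁺    ∔1 = ⊤⁺

    r : F Ord → Ord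
    r (Γ , true)  = 𝟎
    r (Γ , false) = min (image (λ A → sup (image _∔1 A)) (sets Γ))

    q : Ord → Bool
    q [ _ ] = true
    q ⊤⁺    = false

    IsRankingFunction : (G : GameStructure ℓ) → Pred (Xmax G) a → (Xmax G → Ord) → Set (ℓ ⊔ a)
    IsRankingFunction G Acc b = ∀ x → x ∉ Acc →
      min (image (λ y → sup (image (λ x′ → b x′ ∔1) (τmin G y))) (τmax G x)) ≤ b x

{-# OPTIONS --safe #-}
-- The values compared in the two notions are minima over sets of suprema, and
-- minima and suprema depend only on the extension of a set.  Hence replacing
-- indexed families by the sets of their members does not change them.  The
-- second equivalence reduces to the first, because the game of c^{G,Acc} and
-- G itself yield the same minima.
module Submission where

open import Axiom.ExcludedMiddle using (ExcludedMiddle)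
open import Data.Bool.Base using (true; false)
open import Data.Product.Base using (_×_; _,_; proj₁; proj₂; ∃; map₂)
open import Data.Sum.Base using (inj₁; inj₂)
open import Function.Base using (_∘_)
open import Function.Bundles using (_⇔_; mk⇔)
open import Function.Construct.Composition using (_⇔-∘_)
open import Function.Construct.Symmetry using (⇔-sym)
open import Level using (Level; suc)
open import Relation.Binary.Construct.Add.Supremum.Strict using ([_]<⊤⁺)
open import Relation.Binary.Definitions using (tri<; tri≈; tri>)
open import Relation.Binary.PropositionalEquality.Core
  using (_≡_; refl; sym; trans; subst)
open import Relation.Nullary.Construct.Add.Supremum using (⊤⁺; [_])
open import Relation.Nullary.Decidable.Core using (does; yes; no)
open import Relation.Nullary.Negation.Core using (contradiction)
open import Relation.Unary using (Pred; _∈_; _∉_; _≐_)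
open import Relation.Unary.Properties using (≐-refl)
open import Defs

private
  variable
    a p p′ : Level

image-cong : ∀ {a b} {A : Set a} {B : Set b} {f g : A → B} {P : Pred A p} {Q : Pred A p′} →
  (∀ x → f x ≡ g x) → P ≐ Q → image f P ≐ image g Q
image-cong f≗g (P⊆Q , Q⊆P) =
    (λ (x , x∈P , fx≡y) → x , P⊆Q x∈P , trans (sym (f≗g x)) fx≡y)
  , (λ (x , x∈Q , gx≡y) → x , Q⊆P x∈Q , trans (f≗g x) gx≡y)

image-∘ : ∀ {a b c} {A : Set a} {B : Set b} {C : Set c} (g : B → C) (f : A → B) (P : Pred A p) →
  image g (image f P) ≐ image (g ∘ f) P
image-∘ g f P =
    (λ { (_ , (x , x∈P , refl) , eq) → x , x∈P , eq })
  , (λ (x , x∈P , eq) → f x , (x , x∈P , refl) , eq)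

module _ (em : ∀ {a} → ExcludedMiddle a) where

  open Classical em

  -- The Boolean component is decided by the very instance of `em` examined here, so each branch
  -- fixes its value.
  accepting-coalgebraOf : ∀ {ℓ} (G : GameStructure ℓ) (Acc : Pred (Xmax G) a) →
    acceptingOf (coalgebraOf G Acc) ≐ Acc
  accepting-coalgebraOf G Acc = to , from
    where
    to : ∀ {x} → does (em {P = x ∈ Acc}) ≡ true → x ∈ Acc
    to {x} eq with em {P = x ∈ Acc}
    ... | yes x∈Acc = x∈Acc
    to () | no _

    from : ∀ {x} → x ∈ Acc → does (em {P = x ∈ Acc}) ≡ true
    from {x} x∈Acc with em {P = x ∈ Acc}
    ... | yes _    = refl
    ... | no x∉Acc = contradiction x∈Acc x∉Acc

  module _ {ℓ} (𝔷 : Ordinal ℓ) where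

    open Ord≤ 𝔷

    ≤-antisym : ∀ {x y} → x ≤ y → y ≤ x → x ≡ y
    ≤-antisym (inj₂ x≡y) _          = x≡y
    ≤-antisym (inj₁ _)   (inj₂ y≡x) = sym y≡x
    ≤-antisym {x} {y} (inj₁ x<y) (inj₁ y<x) with <-cmp x y
    ... | tri< _ _ y≮x = contradiction y<x y≮x
    ... | tri≈ _ x≡y _ = x≡y
    ... | tri> x≮y _ _ = contradiction x<y x≮y

    min-isLeast : (S : Pred Ord p) → ∃ S → IsLeast S (min S)
    min-isLeast S nonempty with em {P = ∃ S}
    ... | yes nonempty′ = proj₂ (least S nonempty′)
    ... | no  empty     = contradiction nonempty empty

    min-empty : (S : Pred Ord p) → (∀ {x} → x ∉ S) → min S ≡ ⊤⁺
    min-empty S empty with em {P = ∃ S}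
    ... | yes (_ , x∈S) = contradiction x∈S empty
    ... | no _          = refl

    min-cong : {S : Pred Ord p} {T : Pred Ord p′} → S ≐ T → min S ≡ min T
    min-cong {S = S} {T} (S⊆T , T⊆S) with em {P = ∃ S}
    -- With `S` empty so is `T`, and both minima take the default value `⊤⁺`.
    ... | no ¬S        = sym (min-empty T λ x∈T → ¬S (_ , T⊆S x∈T))
    -- In this branch `min S` has already reduced to the element chosen by `least`. Each of the two
    -- least elements lies in the other set, so antisymmetry identifies them.
    ... | yes nonempty with least S nonempty | min-isLeast T (map₂ S⊆T nonempty)
    ... | _ , m∈S , m≤ | n∈T , n≤ = ≤-antisym (m≤ (T⊆S n∈T)) (n≤ (S⊆T m∈S))

    sup-cong : {S : Pred Ord p} {T : Pred Ord p′} → S ≐ T → sup S ≡ sup T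
    sup-cong (S⊆T , T⊆S) = min-cong ((λ ub x∈T → ub (T⊆S x∈T)) , (λ ub x∈S → ub (S⊆T x∈S)))

    -- Every element is vacuously an upper bound of `∅`, so the least upper bound lies below all of
    -- them.
    𝟎-minimum : ∀ x → 𝟎 ≤ x
    𝟎-minimum x = proj₂ (min-isLeast _ (x , λ ())) λ ()

    -- Besides the `S i`, `setOf S P` contains every subset extensionally equal to one of them; as
    -- `f` respects `≐`, these contribute no new values.
    min-image-setOf : {I : Set (suc ℓ)} {X : Set ℓ} (f : 𝒫 X → Ord) →
      (∀ {A B} → A ≐ B → f A ≡ f B) → (S : I → 𝒫 X) (P : Pred I (suc ℓ)) →
      min (image f (sets (setOf S P))) ≡ min (image (f ∘ S) P)
    min-image-setOf f f-cong S P = min-cong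
      ( (λ (_ , (i , i∈P , Si≐B) , fB≡y) → i , i∈P , trans (f-cong Si≐B) fB≡y)
      , (λ (i , i∈P , eq) → S i , (i , i∈P , ≐-refl) , eq))

    sup-image-cong : ∀ {X : Set ℓ} (f : X → Ord) {A B : 𝒫 X} → A ≐ B →
      sup (image f A) ≡ sup (image f B)
    sup-image-cong f A≐B = sup-cong (image-cong (λ _ → refl) A≐B)

    gameValue : (G : GameStructure ℓ) → (Xmax G → Ord) → Xmax G → Ord
    gameValue G b x = min (image (λ y → sup (image (λ x′ → b x′ ∔1) (τmin G y))) (τmax G x))

    -- First the outer minimum is pulled back along `image b` to the members of `Γ`, then the two
    -- nested images inside each supremum are fused.
    r-F₁ : {X : Set ℓ} (b : X → Ord) (Γ : 𝒫² X) →
      r (F₁ b (Γ , false)) ≡ min (image (λ A → sup (image (λ x → b x ∔1) A)) (sets Γ))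
    r-F₁ b Γ = trans
      (min-image-setOf _ (sup-image-cong _∔1) (image b) (sets Γ))
      (min-cong (image-cong (λ A → sup-cong (image-∘ _∔1 b A)) ≐-refl))

    -- Passing to the coalgebra merges positions in `Xmin G` with the same successors, which is
    -- harmless since the supremum at such a position depends only on its successor set.
    gameValue-coalgebraOf : (G : GameStructure ℓ) (Acc : Pred (Xmax G) a) (b : Xmax G → Ord) →
      ∀ x → gameValue (gameOf (coalgebraOf G Acc)) b x ≡ gameValue G b x
    gameValue-coalgebraOf G Acc b x =
      min-image-setOf _ (sup-image-cong _) (τmin G) (τmax G x)

    -- The equivalence holds state by state: at accepting states both conditions are void, the bound
    -- by `𝟎` being automatic, and elsewhere `r-F₁` equates the two values.
    rankingArrow⇔rankingFunction : {X : Set ℓ} (c : Coalgebra X) (b : X → Ord) →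
      IsRankingArrow r _⊑_ c b ⇔ IsRankingFunction (gameOf c) (acceptingOf c) b
    rankingArrow⇔rankingFunction {X} c b = mk⇔
      (λ arrow x → to (c x) (arrow x)) (λ ranking x → from (c x) (ranking x))
      where
      value : 𝒫² X → Ord
      value Γ = min (image (λ A → sup (image (λ x → b x ∔1) A)) (sets Γ))

      -- Generalising `c x` to an arbitrary `s` lets `r` compute once the Boolean is matched.
      to : ∀ {u} (s : F X) → r (F₁ b s) ≤ u → proj₂ s ∉ (_≡ true) → value (proj₁ s) ≤ u
      to (Γ , true)  _   t≢true = contradiction refl t≢true
      to (Γ , false) r≤u _      = subst (_≤ _) (r-F₁ b Γ) r≤u

      from : ∀ {u} (s : F X) → (proj₂ s ∉ (_≡ true) → value (proj₁ s) ≤ u) → r (F₁ b s) ≤ u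
      from (Γ , true)  _ = 𝟎-minimum _
      from (Γ , false) h = subst (_≤ _) (sym (r-F₁ b Γ)) (h λ ())

    rankingFunction-coalgebraOf : (G : GameStructure ℓ) (Acc : Pred (Xmax G) a) (b : Xmax G → Ord) →
      let c = coalgebraOf G Acc in
      IsRankingFunction (gameOf c) (acceptingOf c) b ⇔ IsRankingFunction G Acc b
    rankingFunction-coalgebraOf G Acc b = mk⇔
      -- Non-membership is contravariant, so the inclusion of accepting sets is used in the
      -- direction opposite to the implication.
      (λ h x x∉Acc → subst (_≤ _) (value≡ x) (h x (x∉Acc ∘ proj₁ accepting)))
      (λ h x x∉Acc → subst (_≤ _) (sym (value≡ x)) (h x (x∉Acc ∘ proj₂ accepting)))
      where
      value≡ = gameValue-coalgebraOf G Acc b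
      accepting = accepting-coalgebraOf G Acc

    <⊤⁺⇔q : ∀ x → (x < ⊤⁺) ⇔ (q x ≡ true)
    <⊤⁺⇔q [ k ] = mk⇔ (λ _ → refl) (λ _ → [ k ]<⊤⁺)
    <⊤⁺⇔q ⊤⁺    = mk⇔ (λ ()) (λ ())

propositionA7 : (em : ∀ {a} → ExcludedMiddle a) {ℓ : Level} (𝔷 : Ordinal ℓ) →
    let open Classical em
        open Ord≤ 𝔷
    in
    ((X : Set ℓ) (c : Coalgebra X) (b : X → Ord) →
    IsRankingArrow r _⊑_ c b ⇔ IsRankingFunction (gameOf c) (acceptingOf c) b)
    × ((G : GameStructure ℓ) (Acc : Pred (Xmax G) ℓ) (b : Xmax G → Ord) →
    IsRankingFunction G Acc b ⇔ IsRankingArrow r _⊑_ (coalgebraOf G Acc) b)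
    × ((X : Set ℓ) (b : X → Ord) (x : X) →
    (b x < ⊤⁺) ⇔ (q (b x) ≡ true))
propositionA7 em 𝔷 =
    (λ _ c b → rankingArrow⇔rankingFunction em 𝔷 c b)
  , (λ G Acc b → ⇔-sym
      (rankingFunction-coalgebraOf em 𝔷 G Acc b
        ⇔-∘ rankingArrow⇔rankingFunction em 𝔷 (Classical.coalgebraOf em G Acc) b))
  , (λ _ b x → <⊤⁺⇔q em 𝔷 (b x))
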